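{- For all integers $k\ge3$ and $n\ge k$ there exist a connected unweighted graph $G$ on $n$ vertices, $k$ singleton groups $R_1=\{r_1\},\dots,R_k=\{r_k\}$ and a source vertex $s$ such that every spanning subgraph $H$ of $G$ satisfying $\sigma_H(s,t)\le\alpha\,\sigma_G(s,t)$ for all $t\in V$ with some $\alpha<2-\frac{2}{k}$ has at least $n$ edges.
   Context: Unweighted means every edge has weight $1$. Paths are walks; lengths count edge weights with multiplicity. A group Steiner path from $s$ to $t$ is a path from $s$ to $t$ containing at least one vertex of each group $R_i$; $\sigma_X(s,t)$ is the minimum length of such a path in graph $X$ (with $s=t$ allowed). -}

module Defs where

open import Level using (0ℓ)
open import Data.Nat using (ℕ; zero; suc; _≤_)
open import Data.Integer using (+_)
open import Data.Rational as ℚ using (ℚ)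
open import Data.Fin using (Fin)
open import Data.Fin.Properties using (_<?_)
open import Data.Fin.Subset using (Subset; _∈_)
open import Data.List using (List; []; _∷_; length; filter; allFin; cartesianProduct)
open import Data.List.Relation.Unary.Any using (Any)
open import Data.Product using (_×_; _,_; ∃; ∃₂)
open import Relation.Nullary.Decidable using (_×-dec_)
open import Relation.Binary.Core using (Rel; _⇒_)
open import Relation.Binary.Definitions using (Decidable; Symmetric)
open import Relation.Binary.PropositionalEquality using (_≡_)
open import Relation.Nullary.Negation using (¬_)
open import Relation.Binary.Construct.Closure.ReflexiveTransitive using (Star; ε; _◅_)

-- Finite simple graphs. All graphs here are unweighted, so the length of a
-- walk is its number of edges, counted with multiplicity.
record Graph (n : ℕ) : Set₁ where
  field
    Adj     : Rel (Fin n) 0ℓ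
    adj?    : Decidable Adj
    adj-sym : Symmetric Adj
    irrefl  : ∀ {v} → ¬ Adj v v

open Graph public

-- Each undirected edge {i , j} is listed once, as the pair with i < j.
edges : ∀ {n} → Graph n → List (Fin n × Fin n)
edges {n} G = filter (λ (i , j) → (i <? j) ×-dec adj? G i j)
                     (cartesianProduct (allFin n) (allFin n))

∣E_∣ : ∀ {n} → Graph n → ℕ
∣E G ∣ = length (edges G)

-- Both graphs have the full vertex set Fin n, so only edges are compared.
SpanningSubgraph : ∀ {n} → Graph n → Graph n → Set
SpanningSubgraph H G = Adj H ⇒ Adj G

Walk : ∀ {n} → Graph n → Fin n → Fin n → Set
Walk G = Star (Adj G)

len : ∀ {n} {G : Graph n} {u v} → Walk G u v → ℕ
len ε       = zero
len {G = G} (_ ◅ w) = suc (len {G = G} w)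

vertices : ∀ {n} {G : Graph n} {u v} → Walk G u v → List (Fin n)
vertices         {u = u} ε       = u ∷ []
vertices {G = G} {u = u} (_ ◅ w) = u ∷ vertices {G = G} w

Connected : ∀ {n} → Graph n → Set
Connected G = ∀ u v → Walk G u v

IsGroupSteiner : ∀ {n k} (G : Graph n) (R : Fin k → Subset n) {s t : Fin n} → Walk G s t → Set
IsGroupSteiner G R w = ∀ i → Any (_∈ R i) (vertices {G = G} w)

-- IsSigma X R s t m says that σ_X(s,t) is defined (finite) and equal to m.
IsSigma : ∀ {n k} → Graph n → (Fin k → Subset n) → Fin n → Fin n → ℕ → Set
IsSigma X R s t m =
    (∃ λ (w : Walk X s t) → IsGroupSteiner X R w × len {G = X} w ≡ m)
  × (∀ (w : Walk X s t) → IsGroupSteiner X R w → m ≤ len {G = X} w)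

-- σ_H(s,t) ≤ α · σ_G(s,t) for every t; in particular σ_H(s,t) must be finite.
-- Rational α loses nothing against real α in the condition "for some α < c":
-- all σ-values are nonnegative, so α may be increased to a rational below c.
ApproxFrom : ∀ {n k} → ℚ → Graph n → Graph n → (Fin k → Subset n) → Fin n → Set
ApproxFrom α H G R s = ∀ t → ∃₂ λ a b →
  IsSigma H R s t a × IsSigma G R s t b × (+ a ℚ./ 1) ℚ.≤ α ℚ.* (+ b ℚ./ 1)

{-# OPTIONS --safe #-}
-- G is a cycle through the k terminals 0, …, k−1 with a path k, …, n−1 attached
-- to k−1, and s = 0; it has n edges. No edge outside the cycle can be dropped,
-- since H must reach every vertex. A cycle edge cannot be dropped either: what
-- remains of the cycle is a path on k vertices, so a closed walk through its
-- two ends has length at least 2(k−1), whereas σ_G(s,s) ≤ k.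
module Submission where

open import Data.Nat using (ℕ; zero; suc; NonZero; _≤_; _<_; _+_; _*_; z≤n; s≤s; s≤s⁻¹; ∣_-_∣; _≤?_; _<?_; _≟_)
open import Data.Nat.Properties hiding (_≤?_; _<?_; _≟_)
open import Data.Integer as ℤ using (+_)
import Data.Integer.Properties as ℤ
import Data.Integer.Solver as ℤSolver
open import Data.Rational as ℚ using (ℚ; _/_)
import Data.Rational.Properties as ℚ
import Data.Rational.Unnormalised as ℚᵘ
import Data.Rational.Unnormalised.Properties as ℚᵘ
open import Data.Fin using (Fin; zero; suc; toℕ; inject₁; inject≤; fromℕ<)
open import Data.Fin.Induction using (<-weakInduction)
open import Data.Fin.Properties using (toℕ-injective; toℕ-inject₁; toℕ<n; toℕ-inject≤; toℕ-fromℕ<; inject≤-injective; injective⇒≤)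
open import Data.Fin.Subset using (⁅_⁆)
open import Data.Fin.Subset.Properties using (x∈⁅x⁆; x∈⁅y⁆⇒x≡y)
open import Data.List using (List; length; lookup)
open import Data.List.Membership.Propositional using (_∈_)
open import Data.List.Membership.Propositional.Properties using (∈-filter⁺; ∈-cartesianProduct⁺; ∈-allFin)
open import Data.List.Relation.Unary.Any as Any using (here; there)
open import Data.List.Relation.Unary.Any.Properties using (lookup-index)
open import Data.Product using (Σ-syntax; _×_; _,_; ∃; proj₁; proj₂)
open import Data.Sum using (_⊎_; inj₁; inj₂; swap)
open import Function.Definitions using (Injective)
open import Relation.Binary.Construct.Closure.ReflexiveTransitive using (ε; _◅_; _◅◅_; fold; reverse)
open import Relation.Binary.Definitions using (tri<; tri≈; tri>)
open import Relation.Binary.PropositionalEquality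
open import Relation.Nullary.Decidable using (Dec; yes; no; _×-dec_; _⊎-dec_; decidable-stable)
open import Relation.Nullary.Negation using (¬_; contradiction)
open import Defs

-- Counting distinct members of a list.

-- Sending `i` to the position of `e i` is injective, since a position determines its entry.
injection-length : ∀ {A : Set} {m} {xs : List A} (e : Fin m → A) → Injective _≡_ _≡_ e →
                   (∀ i → e i ∈ xs) → m ≤ length xs
injection-length {xs = xs} e e-inj e∈xs = injective⇒≤ {f = λ i → Any.index (e∈xs i)} λ {i} {j} eq →
  e-inj (trans (lookup-index (e∈xs i)) (trans (cong (lookup xs) eq) (sym (lookup-index (e∈xs j)))))

∈-edges : ∀ {n} (G : Graph n) {i j} → toℕ i < toℕ j → Adj G i j → (i , j) ∈ edges G
∈-edges G {i} {j} i<j ij = ∈-filter⁺ _ (∈-cartesianProduct⁺ (∈-allFin i) (∈-allFin j)) (i<j , ij)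

-- Lower bounds on walk lengths from a 1-Lipschitz potential.

module _ {n} (H : Graph n) (f : Fin n → ℕ) (lipschitz : ∀ {u v} → Adj H u v → ∣ f u - f v ∣ ≤ 1) where

  open ≤-Reasoning

  private
    d : Fin n → Fin n → ℕ
    d x y = ∣ f x - f y ∣

  walk-lipschitz : ∀ {u v} (w : Walk H u v) → d u v ≤ len {G = H} w
  walk-lipschitz {u} ε = ≤-reflexive (∣n-n∣≡0 (f u))
  walk-lipschitz {u} {v} (_◅_ {j = x} e w) = begin
    d u v                ≤⟨ ∣-∣-triangle (f u) (f x) (f v) ⟩
    d u x + d x v        ≤⟨ +-mono-≤ (lipschitz e) (walk-lipschitz w) ⟩
    suc (len {G = H} w)  ∎

  -- The walk splits at its visit to `x`, and the two pieces are bounded separately.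
  visit-lipschitz : ∀ {u v x} (w : Walk H u v) → x ∈ vertices {G = H} w →
                    d u x + d x v ≤ len {G = H} w
  visit-lipschitz {u} ε (here refl) =
    ≤-reflexive (cong₂ _+_ (∣n-n∣≡0 (f u)) (∣n-n∣≡0 (f u)))
  visit-lipschitz {u} {v} w@(_ ◅ _) (here refl) = begin
    d u u + d u v    ≡⟨ cong (_+ d u v) (∣n-n∣≡0 (f u)) ⟩
    d u v            ≤⟨ walk-lipschitz w ⟩
    len {G = H} w    ∎
  visit-lipschitz {u} {v} {x} (_◅_ {j = y} e w) (there x∈w) = begin
    d u x + d x v
      ≤⟨ +-monoˡ-≤ _ (∣-∣-triangle (f u) (f y) (f x)) ⟩
    d u y + d y x + d x v
      ≡⟨ +-assoc (d u y) _ _ ⟩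
    d u y + (d y x + d x v)
      ≤⟨ +-mono-≤ (lipschitz e) (visit-lipschitz w x∈w) ⟩
    suc (len {G = H} w) ∎

  -- Adding d u v closes the walk up, which makes the bound independent of the
  -- order in which x and y are visited.
  start-and-visit : ∀ {u v y} (w : Walk H u v) → y ∈ vertices {G = H} w →
                    d u y + d u y ≤ len {G = H} w + d u v
  start-and-visit {u} {v} {y} w y∈w = begin
    d u y + d u y            ≤⟨ +-monoʳ-≤ (d u y) (∣-∣-triangle (f u) (f v) (f y)) ⟩
    d u y + (d u v + d v y)  ≡⟨ cong (_+_ (d u y)) (trans (+-comm (d u v) _) (cong (_+ d u v) (∣-∣-comm (f v) (f y)))) ⟩
    d u y + (d y v + d u v)  ≡⟨ +-assoc (d u y) _ _ ⟨
    d u y + d y v + d u v    ≤⟨ +-monoˡ-≤ _ (visit-lipschitz w y∈w) ⟩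
    len {G = H} w + d u v    ∎

  -- Prepending an edge lengthens the walk by one and lowers `d u v` by at most one, so the
  -- right-hand side never drops. This reduces to the case where the walk starts at `x` or `y`.
  two-visits : ∀ {u v x y} (w : Walk H u v) → x ∈ vertices {G = H} w → y ∈ vertices {G = H} w →
               d x y + d x y ≤ len {G = H} w + d u v
  two-visits ε (here refl) y∈w = start-and-visit ε y∈w
  two-visits w@(_ ◅ _) (here refl) y∈w = start-and-visit w y∈w
  two-visits {u} {v} {x} w@(_ ◅ _) x∈w@(there _) (here refl) =
    subst (λ δ → δ + δ ≤ len {G = H} w + d u v) (∣-∣-comm (f u) (f x)) (start-and-visit w x∈w)
  two-visits {u} {v} {x} {y} (_◅_ {j = z} e w) (there x∈w) (there y∈w) = begin
    d x y + d x y
      ≤⟨ two-visits w x∈w y∈w ⟩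
    len {G = H} w + d z v
      ≤⟨ +-monoʳ-≤ (len {G = H} w) (∣-∣-triangle (f z) (f u) (f v)) ⟩
    len {G = H} w + (d z u + d u v)
      ≤⟨ +-monoʳ-≤ (len {G = H} w) (+-monoˡ-≤ _ (≤-trans (≤-reflexive (∣-∣-comm (f z) (f u))) (lipschitz e))) ⟩
    len {G = H} w + suc (d u v)
      ≡⟨ +-suc (len {G = H} w) _ ⟩
    suc (len {G = H} w) + d u v ∎

  closed-walk-length : ∀ {u x y} (w : Walk H u u) → x ∈ vertices {G = H} w → y ∈ vertices {G = H} w →
                       d x y + d x y ≤ len {G = H} w
  closed-walk-length {u} {x} {y} w x∈w y∈w = begin
    d x y + d x y           ≤⟨ two-visits w x∈w y∈w ⟩
    len {G = H} w + d u u   ≡⟨ cong (_+_ (len {G = H} w)) (∣n-n∣≡0 (f u)) ⟩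
    len {G = H} w + 0       ≡⟨ +-identityʳ _ ⟩
    len {G = H} w           ∎

-- Arithmetic of the ratio 2 - 2/k.

-- With k = `suc K`, the threshold times the tour length k is exactly the 2(k-1) forced by a missing
-- cycle edge. Unnormalised fractions turn this into an integer identity.
2-2/k*k : ∀ K → ((+ 2 / 1) ℚ.- (+ 2 / suc K)) ℚ.* (+ suc K / 1) ≡ + (K + K) / 1
2-2/k*k K = ℚ.toℚᵘ-injective (begin
  ℚ.toℚᵘ (((+ 2 / 1) ℚ.- (+ 2 / suc K)) ℚ.* (+ suc K / 1))
    ≈⟨ ℚ.toℚᵘ-homo-* ((+ 2 / 1) ℚ.- (+ 2 / suc K)) (+ suc K / 1) ⟩
  ℚ.toℚᵘ ((+ 2 / 1) ℚ.- (+ 2 / suc K)) ℚᵘ.* ℚ.toℚᵘ (+ suc K / 1)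
    ≈⟨ ℚᵘ.*-cong (ℚ.toℚᵘ-homo-+ (+ 2 / 1) (ℚ.- (+ 2 / suc K))) (ℚ.toℚᵘ-fromℚᵘ (ℚᵘ.mkℚᵘ (+ suc K) 0)) ⟩
  (ℚ.toℚᵘ (+ 2 / 1) ℚᵘ.+ ℚ.toℚᵘ (ℚ.- (+ 2 / suc K))) ℚᵘ.* ℚᵘ.mkℚᵘ (+ suc K) 0
    ≈⟨ ℚᵘ.*-congʳ (ℚᵘ.+-congʳ (ℚ.toℚᵘ (+ 2 / 1)) (ℚᵘ.≃-trans (ℚ.toℚᵘ-homo‿- (+ 2 / suc K)) (ℚᵘ.-‿cong (ℚ.toℚᵘ-fromℚᵘ (ℚᵘ.mkℚᵘ (+ 2) K))))) ⟩
  (ℚᵘ.mkℚᵘ (+ 2) 0 ℚᵘ.- ℚᵘ.mkℚᵘ (+ 2) K) ℚᵘ.* ℚᵘ.mkℚᵘ (+ suc K) 0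
    ≈⟨ ℚᵘ.*≡* numerators ⟩
  ℚᵘ.mkℚᵘ (+ (K + K)) 0
    ≈⟨ ℚ.toℚᵘ-fromℚᵘ (ℚᵘ.mkℚᵘ (+ (K + K)) 0) ⟨
  ℚ.toℚᵘ (+ (K + K) / 1) ∎)
  where
  open import Relation.Binary.Reasoning.Setoid ℚᵘ.≃-setoid
  open ℤSolver.+-*-Solver
  denominators : (1 * suc K) * 1 ≡ suc K
  denominators = trans (*-identityʳ (1 * suc K)) (*-identityˡ (suc K))
  numerators : (+ 2 ℤ.* + suc K ℤ.+ ℤ.- (+ 2) ℤ.* + 1) ℤ.* + suc K ℤ.* + 1 ≡
               + (K + K) ℤ.* + ((1 * suc K) * 1)
  -- With the denominator reduced to `suc K`, both sides are polynomials in `+ K`.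
  numerators rewrite denominators =
    solve 1 (λ x → ((con (+ 2) :* (con (+ 1) :+ x) :+ con (ℤ.- (+ 2)) :* con (+ 1)) :* (con (+ 1) :+ x)) :* con (+ 1)
                   := (x :+ x) :* (con (+ 1) :+ x)) refl (+ K)

fromℕ-mono-≤ : ∀ {a b} → a ≤ b → (+ a / 1) ℚ.≤ (+ b / 1)
fromℕ-mono-≤ {a} {b} a≤b = ℚ.toℚᵘ-cancel-≤ (begin
  ℚ.toℚᵘ (+ a / 1)   ≃⟨ ℚ.toℚᵘ-fromℚᵘ (ℚᵘ.mkℚᵘ (+ a) 0) ⟩
  ℚᵘ.mkℚᵘ (+ a) 0    ≤⟨ ℚᵘ.*≤* (ℤ.*-monoʳ-≤-nonNeg (+ 1) (ℤ.+≤+ a≤b)) ⟩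
  ℚᵘ.mkℚᵘ (+ b) 0    ≃⟨ ℚ.toℚᵘ-fromℚᵘ (ℚᵘ.mkℚᵘ (+ b) 0) ⟨
  ℚ.toℚᵘ (+ b / 1)   ∎)
  where open ℚᵘ.≤-Reasoning

fromℕ-pos : ∀ b → ℚ.Positive (+ suc b / 1)
fromℕ-pos b = ℚ.normalize-pos (suc b) 1

-- For c = 2 - 2/k and b > 0: αb < cb ≤ ck = 2K ≤ a. The case b = 0 is separate, because the strict
-- step scales by a positive factor; there 0 < 2K ≤ a ≤ 0.
stretch-bound : ∀ {K a b α} → 0 < K → α ℚ.< (+ 2 / 1) ℚ.- (+ 2 / suc K) → K + K ≤ a → b ≤ suc K →
                ¬ ((+ a / 1) ℚ.≤ α ℚ.* (+ b / 1))
stretch-bound {suc K} {a} {zero} {α} _ _ 2K≤a _ a≤αb =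
  ℚ.<-irrefl refl (begin-strict
    ℚ.0ℚ                        <⟨ ℚ.positive⁻¹ _ {{fromℕ-pos (K + suc K)}} ⟩
    + (suc K + suc K) / 1       ≤⟨ fromℕ-mono-≤ {b = a} 2K≤a ⟩
    + a / 1                     ≤⟨ a≤αb ⟩
    α ℚ.* ℚ.0ℚ                  ≡⟨ ℚ.*-zeroʳ α ⟩
    ℚ.0ℚ                        ∎)
  where open ℚ.≤-Reasoning
stretch-bound {K} {a} {suc b} {α} _ α<c 2K≤a b≤k a≤αb =
  ℚ.<-irrefl refl (begin-strict
    α ℚ.* (+ suc b / 1)   <⟨ ℚ.*-monoˡ-<-pos (+ suc b / 1) {{fromℕ-pos b}} α<c ⟩
    c ℚ.* (+ suc b / 1)   ≤⟨ ℚ.*-monoˡ-≤-nonNeg c {{ℚ.nonNegative 0≤c}} (fromℕ-mono-≤ b≤k) ⟩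
    c ℚ.* (+ suc K / 1)   ≡⟨ 2-2/k*k K ⟩
    + (K + K) / 1         ≤⟨ fromℕ-mono-≤ {b = a} 2K≤a ⟩
    + a / 1               ≤⟨ a≤αb ⟩
    α ℚ.* (+ suc b / 1)   ∎)
  where
  open ℚ.≤-Reasoning
  c : ℚ
  c = (+ 2 / 1) ℚ.- (+ 2 / suc K)
  0≤c : ℚ.0ℚ ℚ.≤ c
  -- The sign of `c` is read off after multiplying by k, where it becomes 0 ≤ 2K.
  0≤c = ℚ.*-cancelʳ-≤-pos (+ suc K / 1) {{fromℕ-pos K}} (begin
    ℚ.0ℚ ℚ.* (+ suc K / 1)  ≡⟨ ℚ.*-zeroˡ (+ suc K / 1) ⟩
    ℚ.0ℚ                    ≤⟨ fromℕ-mono-≤ {0} {K + K} z≤n ⟩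
    + (K + K) / 1           ≡⟨ 2-2/k*k K ⟨
    c ℚ.* (+ suc K / 1)     ∎)

-- A potential on the cycle with one edge deleted.

∣n-1+n∣≡1 : ∀ n → ∣ n - suc n ∣ ≡ 1
∣n-1+n∣≡1 zero    = refl
∣n-1+n∣≡1 (suc n) = ∣n-1+n∣≡1 n

-- Deleting the edge {j , j+1} from the cycle 0, …, K leaves the path
-- j+1, …, K, 0, …, j, along which this function takes the values j+1, …, K+1+j.
unroll : ℕ → ℕ → ℕ → ℕ
unroll K j x with x ≤? j
... | yes _ = suc K + x
... | no _  = x

unroll-≤ : ∀ K {j x} → x ≤ j → unroll K j x ≡ suc K + x
unroll-≤ K {j} {x} x≤j with x ≤? j
... | yes _  = refl
... | no x≰j = contradiction x≤j x≰j

unroll-> : ∀ K {j x} → j < x → unroll K j x ≡ x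
unroll-> K {j} {x} j<x with x ≤? j
... | yes x≤j = contradiction j<x (≤⇒≯ x≤j)
... | no _    = refl

unroll-suc : ∀ K {j x} → x ≢ j → ∣ unroll K j x - unroll K j (suc x) ∣ ≡ 1
unroll-suc K {j} {x} x≢j with <-cmp x j
... | tri< x<j _ _ rewrite unroll-≤ K (<⇒≤ x<j) | unroll-≤ K x<j =
  trans (∣m+n-m+o∣≡∣n-o∣ (suc K) x (suc x)) (∣n-1+n∣≡1 x)
... | tri≈ _ x≡j _ = contradiction x≡j x≢j
... | tri> _ _ j<x rewrite unroll-> K j<x | unroll-> K (m<n⇒m<1+n j<x) = ∣n-1+n∣≡1 x

-- This fixes the shift at `suc K`: vertex 0 must get the value right after that of vertex `K`,
-- which stays unshifted because `j < K`.
unroll-chord : ∀ K {j} → j < K → ∣ unroll K j 0 - unroll K j K ∣ ≡ 1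
unroll-chord K {j} j<K rewrite unroll-≤ K {j} z≤n | unroll-> K j<K | +-identityʳ K =
  trans (∣-∣-comm (suc K) K) (∣n-1+n∣≡1 K)

unroll-spread : ∀ K j → ∣ unroll K j j - unroll K j (suc j) ∣ ≡ K
unroll-spread K j rewrite unroll-≤ K (≤-refl {j}) | unroll-> K (n<1+n j) | +-comm K j =
  trans (∣-∣-comm (j + K) j) (∣m-m+n∣≡n j K)

-- The graph: a cycle with a path attached.

module Lollipop (K m : ℕ) (2≤K : 2 ≤ K) (K≤m : K ≤ m) where

  -- Each edge is oriented upwards, so later case analyses treat one direction only. The second
  -- summand is the chord that closes the cycle.
  Step : Fin (suc m) → Fin (suc m) → Set
  Step u v = toℕ v ≡ suc (toℕ u) ⊎ (toℕ u ≡ 0 × toℕ v ≡ K)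

  step? : ∀ u v → Dec (Step u v)
  step? u v = (toℕ v ≟ suc (toℕ u)) ⊎-dec ((toℕ u ≟ 0) ×-dec (toℕ v ≟ K))

  step-irrefl : ∀ {v} → ¬ Step v v
  step-irrefl (inj₁ v≡1+v) = 1+n≢n (sym v≡1+v)
  step-irrefl (inj₂ (v≡0 , v≡K)) = contradiction (subst (2 ≤_) (trans (sym v≡K) v≡0) 2≤K) λ ()

  G : Graph (suc m)
  G = record
    { Adj     = λ u v → Step u v ⊎ Step v u
    ; adj?    = λ u v → step? u v ⊎-dec step? v u
    ; adj-sym = swap
    ; irrefl  = λ { (inj₁ e) → step-irrefl e ; (inj₂ e) → step-irrefl e }
    }

  junction : Fin (suc m)
  junction = fromℕ< (s≤s K≤m)

  toℕ-junction : toℕ junction ≡ K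
  toℕ-junction = toℕ-fromℕ< (s≤s K≤m)

  terminal : Fin (suc K) → Fin (suc m)
  terminal i = inject≤ i (s≤s K≤m)

  terminal-surjective : ∀ x → toℕ x ≤ K → ∃ λ i → terminal i ≡ x
  terminal-surjective x x≤K = fromℕ< (s≤s x≤K) , toℕ-injective
    (trans (toℕ-inject≤ _ (s≤s K≤m)) (toℕ-fromℕ< (s≤s x≤K)))

  -- The descent u, u-1, ..., 0. Two descents joined at 0 give connectivity; one from `junction`
  -- gives the tour.
  Sweep : Fin (suc m) → Set
  Sweep u = Σ[ w ∈ Walk G u zero ]
    (len {G = G} w ≡ toℕ u × (∀ x → toℕ x ≤ toℕ u → x ∈ vertices {G = G} w))

  sweep : ∀ u → Sweep u
  sweep = <-weakInduction Sweep (ε , refl , λ x x≤0 → here (toℕ-injective (n≤0⇒n≡0 x≤0))) extend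
    where
    extend : ∀ i → Sweep (inject₁ i) → Sweep (suc i)
    extend i (w , len-w , visits) =
        inj₂ (inj₁ (cong suc (sym (toℕ-inject₁ i)))) ◅ w
      , cong suc (trans len-w (toℕ-inject₁ i))
      , λ x x≤1+i → visit x (m≤n⇒m<n∨m≡n x≤1+i)
      where
      visit : ∀ x → toℕ x < suc (toℕ i) ⊎ toℕ x ≡ suc (toℕ i) → x ∈ _
      visit x (inj₁ (s≤s x≤i)) = there (visits x (≤-trans x≤i (≤-reflexive (sym (toℕ-inject₁ i)))))
      visit x (inj₂ x≡1+i) = here (toℕ-injective x≡1+i)

  connected : Connected G
  connected u v = proj₁ (sweep u) ◅◅ reverse (adj-sym G) (proj₁ (sweep v))

  R : Fin (suc K) → _
  R i = ⁅ terminal i ⁆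

  -- Cross the chord from 0 to `K`, then descend to 0: 1 + K steps through every terminal.
  tour-≤ : ∀ {b} → IsSigma G R zero zero b → b ≤ suc K
  tour-≤ {b} (_ , minimal) with sweep junction
  ... | w , len-w , visits = subst (λ l → b ≤ l) (cong suc (trans len-w toℕ-junction))
    (minimal (inj₁ (inj₂ (refl , toℕ-junction)) ◅ w) λ i →
      there (Any.map (λ { refl → x∈⁅x⁆ (terminal i) }) (visits (terminal i) (terminal≤junction i))))
    where
    terminal≤junction : ∀ i → toℕ (terminal i) ≤ toℕ junction
    terminal≤junction i = subst₂ _≤_ (sym (toℕ-inject≤ i (s≤s K≤m))) (sym toℕ-junction) (s≤s⁻¹ (toℕ<n i))

  -- Every edge of `G` is forced into `H`.

  module _ (H : Graph (suc m)) (H⊆G : SpanningSubgraph H G) (α : ℚ)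
           (α<2-2/k : α ℚ.< (+ 2 / 1) ℚ.- (+ 2 / suc K)) (approx : ApproxFrom α H G R zero) where

    -- `Adj H u v` is handed to the check so that the missing edge can be ruled out there.
    step-lipschitz : (f : Fin (suc m) → ℕ) →
                     (∀ {u v} → Step u v → Adj H u v → ∣ f u - f v ∣ ≤ 1) →
                     ∀ {u v} → Adj H u v → ∣ f u - f v ∣ ≤ 1
    step-lipschitz f step {u} {v} uv with H⊆G uv
    ... | inj₁ u→v = step u→v uv
    ... | inj₂ v→u = subst (_≤ 1) (∣-∣-comm (f v) (f u)) (step v→u (adj-sym H uv))

    -- Take t = s = 0. All cycle vertices are terminals, so a closed group Steiner walk in `H` meets
    -- both `x` and `y` and has length at least 2K, against a tour of at most K + 1 in `G`.
    no-spread-potential : (f : Fin (suc m) → ℕ) →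
      (∀ {u v} → Step u v → Adj H u v → ∣ f u - f v ∣ ≤ 1) →
      ∀ x y → toℕ x ≤ K → toℕ y ≤ K → ¬ (∣ f x - f y ∣ ≡ K)
    no-spread-potential f step x y x≤K y≤K spread with approx zero
    ... | a , b , ((w , steiner , len-w) , _) , σG , a≤αb =
      stretch-bound (≤-trans (s≤s z≤n) 2≤K) α<2-2/k 2K≤a (tour-≤ σG) a≤αb
      where
      visited : ∀ z → toℕ z ≤ K → z ∈ vertices {G = H} w
      visited z z≤K with terminal-surjective z z≤K
      ... | i , refl = Any.map (λ v∈R → sym (x∈⁅y⁆⇒x≡y (terminal i) v∈R)) (steiner i)
      2K≤a : K + K ≤ a
      2K≤a = subst₂ _≤_ (cong₂ _+_ spread spread) len-w
        (closed-walk-length H f (step-lipschitz f step) w (visited x x≤K) (visited y y≤K))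

    -- Without the chord only path edges remain, and the vertex numbering itself is the potential.
    chord∈H : Adj H zero junction
    chord∈H = decidable-stable (adj? H zero junction) λ missing →
      no-spread-potential toℕ (step missing) zero junction z≤n (≤-reflexive toℕ-junction) toℕ-junction
      where
      step : ¬ Adj H zero junction → ∀ {u v} → Step u v → Adj H u v → ∣ toℕ u - toℕ v ∣ ≤ 1
      step missing {u} (inj₁ v≡1+u) _ rewrite v≡1+u = ≤-reflexive (∣n-1+n∣≡1 (toℕ u))
      step missing (inj₂ (u≡0 , v≡K)) uv = contradiction
        (subst₂ (Adj H) (toℕ-injective u≡0) (toℕ-injective (trans v≡K (sym toℕ-junction))) uv) missing

    -- The potential is `unroll` at the missing edge. Tail vertices lie above `i`, where it is the
    -- identity, so `unroll-suc` covers tail edges too.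
    cycle-edge∈H : ∀ i → toℕ i < K → Adj H (inject₁ i) (suc i)
    cycle-edge∈H i i<K = decidable-stable (adj? H (inject₁ i) (suc i)) λ missing →
      no-spread-potential f (step missing) (inject₁ i) (suc i)
        (≤-trans (≤-reflexive (toℕ-inject₁ i)) (<⇒≤ i<K)) i<K spread
      where
      f : Fin (suc m) → ℕ
      f x = unroll K (toℕ i) (toℕ x)
      spread : ∣ f (inject₁ i) - f (suc i) ∣ ≡ K
      spread rewrite toℕ-inject₁ i = unroll-spread K (toℕ i)
      step : ¬ Adj H (inject₁ i) (suc i) → ∀ {u v} → Step u v → Adj H u v → ∣ f u - f v ∣ ≤ 1
      step missing {u} {v} (inj₁ v≡1+u) uv = subst (λ x → ∣ f u - unroll K (toℕ i) x ∣ ≤ 1) (sym v≡1+u)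
        (≤-reflexive (unroll-suc K λ u≡i → missing (subst₂ (Adj H)
          (toℕ-injective (trans u≡i (sym (toℕ-inject₁ i))))
          (toℕ-injective (trans v≡1+u (cong suc u≡i))) uv)))
      step _ (inj₂ (u≡0 , v≡K)) _ rewrite u≡0 | v≡K = ≤-reflexive (unroll-chord K i<K)

    -- Without this edge the set {0, ..., i} is closed under adjacency in `H`, so no walk from 0
    -- reaches i+1.
    tail-edge∈H : ∀ i → K ≤ toℕ i → Adj H (inject₁ i) (suc i)
    tail-edge∈H i K≤i with approx (suc i)
    ... | _ , _ , ((w , _) , _) , _ = decidable-stable (adj? H (inject₁ i) (suc i)) λ missing →
      1+n≰n (fold (λ u v → toℕ u ≤ toℕ i → toℕ v ≤ toℕ i) (λ e stays u≤i → stays (step missing e u≤i)) (λ u≤i → u≤i) w z≤n)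
      where
      step : ¬ Adj H (inject₁ i) (suc i) → ∀ {u v} → Adj H u v → toℕ u ≤ toℕ i → toℕ v ≤ toℕ i
      step missing {u} uv u≤i with H⊆G uv
      ... | inj₂ (inj₁ u≡1+v) = ≤-trans (n≤1+n _) (≤-trans (≤-reflexive (sym u≡1+v)) u≤i)
      ... | inj₂ (inj₂ (v≡0 , _)) = ≤-trans (≤-reflexive v≡0) z≤n
      -- The chord stays inside the set because `K ≤ i`.
      ... | inj₁ (inj₂ (_ , v≡K)) = ≤-trans (≤-reflexive v≡K) K≤i
      ... | inj₁ (inj₁ v≡1+u) with m≤n⇒m<n∨m≡n u≤i
      ...   | inj₁ u<i = ≤-trans (≤-reflexive v≡1+u) u<i
      ...   | inj₂ u≡i = contradiction (subst₂ (Adj H)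
        (toℕ-injective (trans u≡i (sym (toℕ-inject₁ i))))
        (toℕ-injective (trans v≡1+u (cong suc u≡i))) uv) missing

    path-edge∈H : ∀ i → Adj H (inject₁ i) (suc i)
    path-edge∈H i with toℕ i <? K
    ... | yes i<K = cycle-edge∈H i i<K
    ... | no i≮K  = tail-edge∈H i (≮⇒≥ i≮K)

    -- Counting the edges of `H`.

    -- Path edges are indexed by their upper endpoint, which leaves index 0 for the chord.
    edge : Fin (suc m) → Fin (suc m) × Fin (suc m)
    edge zero    = zero , junction
    edge (suc i) = inject₁ i , suc i

    -- The ends of the chord differ by `K`, at least 2; those of a path edge by 1.
    chord≢path-edge : ∀ i → edge zero ≢ edge (suc i)
    chord≢path-edge i eq = contradiction 2≤K (subst (λ x → ¬ 2 ≤ x) (sym K≡1) λ { (s≤s ()) })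
      where
      0≡i : 0 ≡ toℕ i
      0≡i = trans (cong (λ e → toℕ (proj₁ e)) eq) (toℕ-inject₁ i)
      K≡1 : K ≡ 1
      K≡1 = trans (sym toℕ-junction) (trans (cong (λ e → toℕ (proj₂ e)) eq) (cong suc (sym 0≡i)))

    edge-injective : Injective _≡_ _≡_ edge
    edge-injective {zero}  {zero}  _  = refl
    edge-injective {zero}  {suc j} eq = contradiction eq (chord≢path-edge j)
    edge-injective {suc i} {zero}  eq = contradiction (sym eq) (chord≢path-edge i)
    edge-injective {suc i} {suc j} eq = cong proj₂ eq

    edge∈H : ∀ i → edge i ∈ edges H
    edge∈H zero    = ∈-edges H (subst (0 <_) (sym toℕ-junction) (≤-trans (s≤s z≤n) 2≤K)) chord∈H
    edge∈H (suc i) = ∈-edges H (s≤s (≤-reflexive (toℕ-inject₁ i))) (path-edge∈H i)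

    size-≥ : suc m ≤ ∣E H ∣
    size-≥ = injection-length edge edge-injective edge∈H

open import Data.Rational using (_-_)

mainTheorem12 : ∀ (k n : ℕ) .{{_ : NonZero k}} → 3 ≤ k → k ≤ n →
    Σ[ G ∈ Graph n ] Σ[ r ∈ (Fin k → Fin n) ] Σ[ s ∈ Fin n ]
    (Connected G
    × Injective _≡_ _≡_ r
    × (∀ (H : Graph n) → SpanningSubgraph H G →
    ∀ (α : ℚ) → α ℚ.< (+ 2 / 1) - (+ 2 / k) →
    ApproxFrom α H G (λ i → ⁅ r i ⁆) s →
    n ≤ ∣E H ∣))
mainTheorem12 (suc K) (suc m) (s≤s 2≤K) (s≤s K≤m) =
  G , terminal , zero , connected , inject≤-injective _ _ _ _ , size-≥
  where open Lollipop K m 2≤K K≤m
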